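{- Let $P\subset\mathbb{R}^d$ be a polytope, $c\in\mathbb{R}^d$ a generic objective function, and $\eta$ a normalization. There is a polytope $\Pi^{\eta}_{P,c}\subset\mathbb{R}^d$, namely the pivot rule polytope of $(P,c)$ and $\eta$ defined in the context, such that for any generic weights $w,w'\in\mathbb{R}^d$ $$\mathcal{A}^{\eta}_{P,c}(w)=\mathcal{A}^{\eta}_{P,c}(w')\quad\Longleftrightarrow\quad (\Pi^{\eta}_{P,c})^{w}=(\Pi^{\eta}_{P,c})^{w'}.$$
   Context: For a polytope $P\subset\mathbb{R}^d$, $V(P)$ denotes its vertex set and $E(P)$ its edges. A linear function $c\in\mathbb{R}^d$ is generic for $P$ if $c^tu\neq c^tv$ for all edges $uv\in E(P)$; then $c$ has a unique maximizing vertex $v_{opt}$, and $(P,c)$ is called a linear program. $\mathrm{Nb}_{P,c}(v)=\{u : uv\in E(P),\ c^tu>c^tv\}$. A $c$-arborescence is a map $\mathcal{A}:V(P)\to V(P)$ with $\mathcal{A}(v_{opt})=v_{opt}$ and $\mathcal{A}(v)\in \mathrm{Nb}_{P,c}(v)$ for $v\neq v_{opt}$. A normalization is a function $\eta:\mathbb{R}^d\to\mathbb{R}$ with $\eta(u-v)\ne 0$ whenever $u\in\mathrm{Nb}_{P,c}(v)$. A weight $w\in\mathbb{R}^d$ is generic if for every $v\neq v_{opt}$ the maximum of $\frac{w^t(u-v)}{\eta(u-v)}$ over $u\in\mathrm{Nb}_{P,c}(v)$ is attained by a unique $u$; then $\mathcal{A}^\eta_{P,c}(w)$ is the $c$-arborescence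 sending each $v\ne v_{opt}$ to this unique maximizer. For a $c$-arborescence $\mathcal{A}$ put $\psi^\eta(\mathcal{A})=\sum_{v\in V(P)}\frac{\mathcal{A}(v)-v}{\eta(\mathcal{A}(v)-v)}$, with the convention $\frac{0}{\eta(0)}=0$. The pivot rule polytope is $$\Pi^\eta_{P,c}=\operatorname{conv}\{\psi^\eta(\mathcal{A}) : \mathcal{A}\text{ a }c\text{ -arborescence of }(P,c)\}.$$ For a polytope $Q\subset\mathbb{R}^d$ and $w\in\mathbb{R}^d$, $Q^w=\{x\in Q : w^tx\ge w^ty\text{ for all }y\in Q\}$ is the face maximizing $w$. -}

module Defs where

open import Algebra.Bundles using (CommutativeRing)
import Algebra.Definitions.RawMonoid as RawMonoid
open import Data.Fin.Base using (Fin)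
open import Data.Fin.Properties using (_≟_)
open import Data.Nat.Base using (ℕ)
open import Data.Product.Base using (_×_; ∃-syntax; Σ-syntax; proj₁)
open import Data.Product using (∃!)
open import Data.Sum.Base using (_⊎_)
open import Data.Vec.Functional using (Vector)
import Data.Vec.Functional.Relation.Binary.Equality.Setoid as VectorEquality
open import Level using (0ℓ; suc)
open import Relation.Binary.Core using (Rel)
open import Relation.Binary.Structures using (IsTotalOrder)
import Relation.Binary.Construct.NonStrictToStrict as ToStrict
open import Relation.Binary.PropositionalEquality.Core using (_≡_; _≢_)
open import Relation.Nullary using (¬_; yes; no)
open import Relation.Unary using (Pred; _∈_; _≐_)

-- The standard library has no real numbers, so ℝ is axiomatised, as a
-- Dedekind-complete ordered field.  Classically these axioms determine ℝ
-- up to isomorphism.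
record CompleteOrderedField : Set (suc 0ℓ) where
  field
    commutativeRing : CommutativeRing 0ℓ 0ℓ

  open CommutativeRing commutativeRing public

  infix  4 _≤_
  infix  8 _⁻¹

  field
    _≤_          : Rel Carrier 0ℓ
    isTotalOrder : IsTotalOrder _≈_ _≤_
    +-monoʳ-≤    : ∀ x {y z} → y ≤ z → x + y ≤ x + z
    *-nonNeg     : ∀ {x y} → 0# ≤ x → 0# ≤ y → 0# ≤ x * y
    0≉1          : ¬ (0# ≈ 1#)
    -- Total, but with no constraint on the value at 0#.
    _⁻¹          : Carrier → Carrier
    ⁻¹-cong      : ∀ {x y} → x ≈ y → x ⁻¹ ≈ y ⁻¹
    *-inverseʳ   : ∀ {x} → ¬ (x ≈ 0#) → x * x ⁻¹ ≈ 1#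

  UpperBound : Pred Carrier 0ℓ → Pred Carrier 0ℓ
  UpperBound S b = ∀ x → x ∈ S → x ≤ b

  field
    complete : ∀ (S : Pred Carrier 0ℓ) → (∃[ x ] x ∈ S) → (∃[ b ] b ∈ UpperBound S) →
               ∃[ s ] (s ∈ UpperBound S × (∀ b → b ∈ UpperBound S → s ≤ b))

  open ToStrict _≈_ _≤_ public using (_<_)
  open RawMonoid +-rawMonoid public using (sum)
  open VectorEquality setoid public using (_≋_)

module PivotRules (ℝ : CompleteOrderedField) where

  open CompleteOrderedField ℝ

  Point : ℕ → Set
  Point d = Vector Carrier d

  infix  7 _∙_
  infixl 6 _⊖_
  infixr 7 _⊛_

  _∙_ : ∀ {d} → Point d → Point d → Carrier
  x ∙ y = sum (λ i → x i * y i)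

  _⊖_ : ∀ {d} → Point d → Point d → Point d
  (x ⊖ y) i = x i - y i

  _⊛_ : ∀ {d} → Carrier → Point d → Point d
  (a ⊛ x) i = a * x i

  ∑ : ∀ {d n} → (Fin n → Point d) → Point d
  ∑ p i = sum (λ k → p k i)

  conv : ∀ {d} → Pred (Point d) 0ℓ → Pred (Point d) 0ℓ
  conv {d} S x = ∃[ n ] Σ[ p ∈ (Fin n → Point d) ] Σ[ a ∈ (Fin n → Carrier) ]
    ( (∀ k → p k ∈ S)
    × (∀ k → 0# ≤ a k)
    × sum a ≈ 1#
    × x ≋ ∑ (λ k → a k ⊛ p k) )

  Range : ∀ {d n} → (Fin n → Point d) → Pred (Point d) 0ℓ
  Range p x = ∃[ k ] x ≋ p k

  IsPolytope : ∀ {d} → Pred (Point d) 0ℓ → Set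
  IsPolytope {d} Q = ∃[ n ] Σ[ p ∈ (Fin n → Point d) ] Q ≐ conv (Range p)

  infix 8 _^_

  _^_ : ∀ {d} → Pred (Point d) 0ℓ → Point d → Pred (Point d) 0ℓ
  (Q ^ w) x = x ∈ Q × (∀ y → y ∈ Q → w ∙ y ≤ w ∙ x)

  -- The nonempty faces of a polytope Q are the sets Q ^ w; its vertices are
  -- those that are points, and its edges those that are segments.
  IsVertex : ∀ {d} → Pred (Point d) 0ℓ → Pred (Point d) 0ℓ
  IsVertex Q v = ∃[ w ] Q ^ w ≐ (λ x → x ≋ v)

  IsEdge : ∀ {d} → Pred (Point d) 0ℓ → Point d → Point d → Set
  IsEdge Q u v =
    ¬ (u ≋ v) × (∃[ w ] Q ^ w ≐ conv (λ x → x ≋ u ⊎ x ≋ v))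

  -- A polytope has finitely many vertices; they are listed without repetition,
  -- in an arbitrary order, so that maps V(P) → V(P) and sums over V(P) can be
  -- expressed through the index set.
  record Polytope (d : ℕ) : Set (suc 0ℓ) where
    field
      body       : Pred (Point d) 0ℓ
      isPolytope : IsPolytope body
      #V         : ℕ
      pt         : Fin #V → Point d
      pt-vertex  : ∀ i → IsVertex body (pt i)
      pt-inj     : ∀ {i j} → pt i ≋ pt j → i ≡ j
      pt-surj    : ∀ {x} → IsVertex body x → ∃[ i ] x ≋ pt i

    V : Set
    V = Fin #V

    E : V → V → Set
    E u v = IsEdge body (pt u) (pt v)

  module _ {d : ℕ} (P : Polytope d) (c : Point d) where

    open Polytope P

    GenericObjective : Set
    GenericObjective = ∀ u v → E u v → ¬ (c ∙ pt u ≈ c ∙ pt v)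

    IsOptimal : V → Set
    IsOptimal v = pt v ∈ body ^ c

    Nb : V → Pred V 0ℓ
    Nb v u = E u v × c ∙ pt v < c ∙ pt u

    record IsNormalization (η : Point d → Carrier) : Set where
      field
        η-cong    : ∀ {x y} → x ≋ y → η x ≈ η y
        η-nonzero : ∀ {u v} → u ∈ Nb v → ¬ (η (pt u ⊖ pt v) ≈ 0#)

    module _ (vₒₚₜ : V) where

      IsArborescence : (V → V) → Set
      IsArborescence 𝒜 = 𝒜 vₒₚₜ ≡ vₒₚₜ × (∀ v → v ≢ vₒₚₜ → 𝒜 v ∈ Nb v)

      module _ (η : Point d → Carrier) where

        slope : Point d → V → V → Carrier
        slope w v u = (w ∙ (pt u ⊖ pt v)) * (η (pt u ⊖ pt v)) ⁻¹

        IsMaximizer : Point d → V → V → Set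
        IsMaximizer w v u =
          u ∈ Nb v × (∀ u′ → u′ ∈ Nb v → slope w v u′ ≤ slope w v u)

        GenericWeight : Point d → Set
        GenericWeight w = ∀ v → v ≢ vₒₚₜ → ∃! _≡_ (IsMaximizer w v)

        pivot : ∀ w → GenericWeight w → V → V
        pivot w generic v with v ≟ vₒₚₜ
        ... | yes _      = vₒₚₜ
        ... | no  v≢vₒₚₜ = proj₁ (generic v v≢vₒₚₜ)

        -- The convention 0 / η(0) = 0 needs no case distinction: when 𝒜 v = v
        -- the vector is 0, and so is its product with any scalar.
        ψ : (V → V) → Point d
        ψ 𝒜 = ∑ (λ v → (η (pt (𝒜 v) ⊖ pt v)) ⁻¹ ⊛ (pt (𝒜 v) ⊖ pt v))

        Π : Pred (Point d) 0ℓ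
        Π = conv (λ x → ∃[ 𝒜 ] (IsArborescence 𝒜 × x ≋ ψ 𝒜))

{-# OPTIONS --safe #-}
-- Since w ∙ ψ 𝒜 = Σ_v slope w v (𝒜 v), the functional w is maximised over the
-- arborescences by maximising every summand separately.  For generic w the
-- pivot arborescence 𝒜(w) is the only one doing so, hence Π ^ w = { ψ 𝒜(w) }.
-- If Π ^ w = Π ^ w′ then ψ 𝒜(w) = ψ 𝒜(w′), so 𝒜(w′) also attains the maximum of
-- w and therefore coincides with 𝒜(w).
module Submission where

open import Axiom.ExcludedMiddle using (ExcludedMiddle)
import Algebra.Properties.Group as GroupProperties
import Algebra.Properties.Ring as RingProperties
import Algebra.Properties.Semiring.Sum as SumProperties
open import Data.Empty using (⊥-elim)
open import Data.Fin.Base using (Fin; zero; suc; finToFun; funToFin)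
open import Data.Fin.Properties using (_≟_; finToFun-funToFin)
open import Data.Nat.Base using (ℕ; zero; suc)
open import Data.Product.Base using (_×_; _,_; ∃-syntax; proj₁; proj₂)
open import Data.Sum.Base using (inj₁; inj₂)
open import Data.Vec.Functional using (Vector)
open import Function.Base using (_∘_; case_of_)
open import Function.Bundles using (_⇔_; mk⇔)
open import Level using (0ℓ)
open import Relation.Binary.Bundles using (Poset)
import Relation.Binary.Reasoning.PartialOrder as PartialOrderReasoning
open import Relation.Binary.PropositionalEquality.Core as ≡ using (_≡_; _≢_; _≗_)
open import Relation.Binary.Structures using (IsTotalOrder)
open import Relation.Nullary using (¬_; Dec; yes; no)
open import Relation.Unary using (Pred; _∈_; _⊆_; _≐_)
open import Defs

-- Inequalities and finite sums in an ordered field.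

module OrderedFieldProperties (ℝ : CompleteOrderedField) where

  open CompleteOrderedField ℝ hiding (zero)
  open IsTotalOrder isTotalOrder public
    using (antisym; isPartialOrder; total; ≤-respˡ-≈; ≤-respʳ-≈)
    renaming (refl to ≤-refl; reflexive to ≤-reflexive; trans to ≤-trans)
  open GroupProperties +-group
    using (\\-leftDividesˡ; \\-leftDividesʳ)
    renaming (⁻¹-involutive to -‿involutive)
  open RingProperties ring using (-1*x≈-x)

  ≤-poset : Poset 0ℓ 0ℓ 0ℓ
  ≤-poset = record { isPartialOrder = isPartialOrder }

  open PartialOrderReasoning ≤-poset

  +-mono-≤ : ∀ {x y u v} → x ≤ y → u ≤ v → x + u ≤ y + v
  +-mono-≤ {x} {y} {u} {v} x≤y u≤v = begin
    x + u  ≤⟨ +-monoʳ-≤ x u≤v ⟩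
    x + v  ≈⟨ +-comm x v ⟩
    v + x  ≤⟨ +-monoʳ-≤ v x≤y ⟩
    v + y  ≈⟨ +-comm v y ⟩
    y + v  ∎

  +-cancelˡ-≤ : ∀ x {y z} → x + y ≤ x + z → y ≤ z
  +-cancelˡ-≤ x {y} {z} x+y≤x+z = begin
    y              ≈⟨ \\-leftDividesʳ x y ⟨
    - x + (x + y)  ≤⟨ +-monoʳ-≤ (- x) x+y≤x+z ⟩
    - x + (x + z)  ≈⟨ \\-leftDividesʳ x z ⟩
    z              ∎

  -- The order axiom for products only concerns nonnegative factors, so `a` is multiplied with the
  -- nonnegative difference `- x + y`.
  *-monoˡ-≤-nonNeg : ∀ {a x y} → 0# ≤ a → x ≤ y → a * x ≤ a * y
  *-monoˡ-≤-nonNeg {a} {x} {y} 0≤a x≤y = begin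
    a * x                    ≈⟨ +-identityʳ (a * x) ⟨
    a * x + 0#               ≤⟨ +-monoʳ-≤ (a * x) (*-nonNeg 0≤a 0≤-x+y) ⟩
    a * x + a * (- x + y)    ≈⟨ distribˡ a x (- x + y) ⟨
    a * (x + (- x + y))      ≈⟨ *-congˡ (\\-leftDividesˡ x y) ⟩
    a * y                    ∎
    where
    0≤-x+y : 0# ≤ - x + y
    0≤-x+y = ≤-respˡ-≈ (-‿inverseˡ x) (+-monoʳ-≤ (- x) x≤y)

  *-cancelˡ-nonZero : ∀ {a} → ¬ (a ≈ 0#) → ∀ {x y} → a * x ≈ a * y → x ≈ y
  *-cancelˡ-nonZero {a} a≉0 {x} {y} ax≈ay = begin-equality
    x               ≈⟨ undo x ⟨
    a ⁻¹ * (a * x)  ≈⟨ *-congˡ ax≈ay ⟩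
    a ⁻¹ * (a * y)  ≈⟨ undo y ⟩
    y               ∎
    where
    undo : ∀ z → a ⁻¹ * (a * z) ≈ z
    undo z = begin-equality
      a ⁻¹ * (a * z)  ≈⟨ *-assoc (a ⁻¹) a z ⟨
      a ⁻¹ * a * z    ≈⟨ *-congʳ (trans (*-comm (a ⁻¹) a) (*-inverseʳ a≉0)) ⟩
      1# * z          ≈⟨ *-identityˡ z ⟩
      z               ∎

  -- If `1#` were at most `0#`, then `- 1#` would be nonnegative, and so would its square, which is
  -- `1#`. Provides the weight of a one-point convex combination.
  0≤1 : 0# ≤ 1#
  0≤1 with total 0# 1#
  ... | inj₁ 0≤1 = 0≤1
  ... | inj₂ 1≤0 = ≤-respʳ-≈ -1*-1≈1 (*-nonNeg 0≤-1 0≤-1)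
    where
    0≤-1 : 0# ≤ - 1#
    0≤-1 = +-cancelˡ-≤ 1# (begin
      1# + 0#      ≈⟨ +-identityʳ 1# ⟩
      1#           ≤⟨ 1≤0 ⟩
      0#           ≈⟨ -‿inverseʳ 1# ⟨
      1# + - 1#    ∎)

    -1*-1≈1 : - 1# * - 1# ≈ 1#
    -1*-1≈1 = trans (-1*x≈-x (- 1#)) (-‿involutive 1#)

  sum-mono-≤ : ∀ {n} {f g : Vector Carrier n} → (∀ i → f i ≤ g i) → sum f ≤ sum g
  sum-mono-≤ {zero}  f≤g = ≤-refl
  sum-mono-≤ {suc n} f≤g = +-mono-≤ (f≤g zero) (sum-mono-≤ (f≤g ∘ suc))

  -- Slack in one summand cannot be made up by the others. Bounding the head lets it cancel and
  -- leaves the hypothesis for the tails; bounding the tails lets them cancel and leaves equality of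
  -- the heads.
  sum-≤-equality : ∀ {n} {f g : Vector Carrier n} →
                   (∀ i → f i ≤ g i) → sum g ≤ sum f → ∀ i → f i ≈ g i
  sum-≤-equality {suc n} {f} {g} f≤g ∑g≤∑f = λ where
      zero    → antisym (f≤g zero) g₀≤f₀
      (suc i) → sum-≤-equality (f≤g ∘ suc) tails i
    where
    f′ g′ : Vector Carrier n
    f′ = f ∘ suc
    g′ = g ∘ suc

    tails : sum g′ ≤ sum f′
    tails = +-cancelˡ-≤ (g zero) (≤-trans ∑g≤∑f (+-mono-≤ (f≤g zero) ≤-refl))

    g₀≤f₀ : g zero ≤ f zero
    g₀≤f₀ = +-cancelˡ-≤ (sum g′) (begin
      sum g′ + g zero  ≈⟨ +-comm (sum g′) (g zero) ⟩
      g zero + sum g′  ≤⟨ ∑g≤∑f ⟩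
      f zero + sum f′  ≤⟨ +-monoʳ-≤ (f zero) (sum-mono-≤ (f≤g ∘ suc)) ⟩
      f zero + sum g′  ≈⟨ +-comm (f zero) (sum g′) ⟩
      sum g′ + f zero  ∎)

-- Linear functionals, convex hulls and their faces.

module Convexity (em : ExcludedMiddle 0ℓ) (ℝ : CompleteOrderedField) where

  open CompleteOrderedField ℝ hiding (zero)
  open OrderedFieldProperties ℝ
  open PivotRules ℝ
  open SumProperties semiring
    using (sum-cong-≋; ∑-comm; *-distribˡ-sum; *-distribʳ-sum)
  open PartialOrderReasoning ≤-poset

  ∙-congˡ : ∀ {d} (w : Point d) {x y} → x ≋ y → w ∙ x ≈ w ∙ y
  ∙-congˡ w x≋y = sum-cong-≋ (λ i → *-congˡ (x≋y i))

  ∙-⊛ : ∀ {d} (w : Point d) a x → w ∙ (a ⊛ x) ≈ a * (w ∙ x)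
  ∙-⊛ w a x = begin-equality
    sum (λ i → w i * (a * x i))  ≈⟨ sum-cong-≋ (λ i → swap (w i) (x i)) ⟩
    sum (λ i → a * (w i * x i))  ≈⟨ *-distribˡ-sum a (λ i → w i * x i) ⟨
    a * (w ∙ x)                  ∎
    where
    swap : ∀ u v → u * (a * v) ≈ a * (u * v)
    swap u v = begin-equality
      u * (a * v)  ≈⟨ *-assoc u a v ⟨
      u * a * v    ≈⟨ *-congʳ (*-comm u a) ⟩
      a * u * v    ≈⟨ *-assoc a u v ⟩
      a * (u * v)  ∎

  ∙-∑ : ∀ {d n} (w : Point d) (p : Fin n → Point d) → w ∙ ∑ p ≈ sum (λ k → w ∙ p k)
  ∙-∑ w p = begin-equality
    sum (λ i → w i * sum (λ k → p k i))  ≈⟨ sum-cong-≋ (λ i → *-distribˡ-sum (w i) (λ k → p k i)) ⟩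
    sum (λ i → sum (λ k → w i * p k i))  ≈⟨ ∑-comm (λ i k → w i * p k i) ⟩
    sum (λ k → sum (λ i → w i * p k i))  ∎

  conv-mono : ∀ {d} (S T : Pred (Point d) 0ℓ) → S ⊆ T → conv S ⊆ conv T
  conv-mono S T S⊆T (n , p , a , p∈S , rest) = n , p , a , (λ k → S⊆T (p∈S k)) , rest

  conv-isPolytope : ∀ {d n} (S : Pred (Point d) 0ℓ) (p : Fin n → Point d) →
                    S ≐ Range p → IsPolytope (conv S)
  conv-isPolytope S p (S⊆p , p⊆S) =
    _ , p , conv-mono S (Range p) S⊆p , conv-mono (Range p) S p⊆S

  ∈conv : ∀ {d} {S : Pred (Point d) 0ℓ} {x q} → q ∈ S → x ≋ q → x ∈ conv S
  ∈conv {x = x} {q} q∈S x≋q =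
    1 , (λ _ → q) , (λ _ → 1#) , (λ _ → q∈S) , (λ _ → 0≤1) , +-identityʳ 1# ,
    (λ i → trans (x≋q i) (sym (trans (+-identityʳ _) (*-identityˡ _))))

  -- The value of `w` at a convex combination is the weighted mean of its values at the generators,
  -- none of which exceeds `w ∙ q`. A mean equal to `w ∙ q` thus forces every generator of nonzero
  -- weight to coincide with `q`.
  conv-face-singleton : ∀ {d} {S : Pred (Point d) 0ℓ} {w q : Point d} → q ∈ S →
    (∀ {p} → p ∈ S → w ∙ p ≤ w ∙ q) →
    (∀ {p} → p ∈ S → w ∙ p ≈ w ∙ q → p ≋ q) →
    conv S ^ w ≐ (_≋ q)
  conv-face-singleton {d} {S} {w} {q} q∈S maximal unique = to , from
    where
    -- Shared by both inclusions: `to` decomposes a maximizer, `from` an arbitrary competitor.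
    module Combination {n : ℕ} (p : Fin n → Point d) (a : Fin n → Carrier)
      (p∈S : ∀ k → p k ∈ S) (0≤a : ∀ k → 0# ≤ a k) (∑a≈1 : sum a ≈ 1#) where

      sum-weighted : ∀ t → sum (λ k → a k * t) ≈ t
      sum-weighted t = begin-equality
        sum (λ k → a k * t)  ≈⟨ *-distribʳ-sum t a ⟨
        sum a * t            ≈⟨ *-congʳ ∑a≈1 ⟩
        1# * t               ≈⟨ *-identityˡ t ⟩
        t                    ∎

      value : ∀ {x} → x ≋ ∑ (λ k → a k ⊛ p k) → w ∙ x ≈ sum (λ k → a k * (w ∙ p k))
      value {x} x≋ = begin-equality
        w ∙ x                          ≈⟨ ∙-congˡ w x≋ ⟩
        w ∙ ∑ (λ k → a k ⊛ p k)        ≈⟨ ∙-∑ w (λ k → a k ⊛ p k) ⟩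
        sum (λ k → w ∙ (a k ⊛ p k))    ≈⟨ sum-cong-≋ (λ k → ∙-⊛ w (a k) (p k)) ⟩
        sum (λ k → a k * (w ∙ p k))    ∎

      termwise : ∀ k → a k * (w ∙ p k) ≤ a k * (w ∙ q)
      termwise k = *-monoˡ-≤-nonNeg (0≤a k) (maximal (p∈S k))

    to : conv S ^ w ⊆ (_≋ q)
    to {x} ((n , p , a , p∈S , 0≤a , ∑a≈1 , x≋) , x-max) i = begin-equality
      x i                           ≈⟨ x≋ i ⟩
      sum (λ k → a k * p k i)       ≈⟨ sum-cong-≋ (λ k → collapse k i) ⟩
      sum (λ k → a k * q i)         ≈⟨ sum-weighted (q i) ⟩
      q i                           ∎
      where
      open Combination p a p∈S 0≤a ∑a≈1

      attained : sum (λ k → a k * (w ∙ q)) ≤ sum (λ k → a k * (w ∙ p k))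
      attained = begin
        sum (λ k → a k * (w ∙ q))    ≈⟨ sum-weighted (w ∙ q) ⟩
        w ∙ q                        ≤⟨ x-max q (∈conv q∈S (λ _ → refl)) ⟩
        w ∙ x                        ≈⟨ value x≋ ⟩
        sum (λ k → a k * (w ∙ p k))  ∎

      collapse : ∀ k → a k ⊛ p k ≋ a k ⊛ q
      -- A generator of weight zero need not be `q`, but both scaled points vanish; any other weight
      -- can be cancelled.
      collapse k j with em {a k ≈ 0#}
      ... | yes a≈0 = begin-equality
        a k * p k j  ≈⟨ *-congʳ a≈0 ⟩
        0# * p k j   ≈⟨ zeroˡ (p k j) ⟩
        0#           ≈⟨ zeroˡ (q j) ⟨
        0# * q j     ≈⟨ *-congʳ a≈0 ⟨
        a k * q j    ∎
      ... | no a≉0 = *-congˡ (unique (p∈S k)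
        (*-cancelˡ-nonZero a≉0 (sum-≤-equality termwise attained k)) j)

    from : (_≋ q) ⊆ conv S ^ w
    from {x} x≋q = ∈conv q∈S x≋q , λ where
      y (n , p , a , p∈S , 0≤a , ∑a≈1 , y≋) →
        let open Combination p a p∈S 0≤a ∑a≈1 in begin
        w ∙ y                        ≈⟨ value y≋ ⟩
        sum (λ k → a k * (w ∙ p k))  ≤⟨ sum-mono-≤ termwise ⟩
        sum (λ k → a k * (w ∙ q))    ≈⟨ sum-weighted (w ∙ q) ⟩
        w ∙ q                        ≈⟨ ∙-congˡ w x≋q ⟨
        w ∙ x                        ∎

-- Generators of the pivot rule polytope.

module PivotRulePolytope
  (em : ExcludedMiddle 0ℓ) (ℝ : CompleteOrderedField)
  {d : ℕ} (P : PivotRules.Polytope ℝ d) (c : PivotRules.Point ℝ d)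
  (vₒₚₜ : PivotRules.Polytope.V P)
  (η : PivotRules.Point ℝ d → CompleteOrderedField.Carrier ℝ)
  where

  open CompleteOrderedField ℝ hiding (zero)
  open PivotRules ℝ
  open OrderedFieldProperties ℝ
  open Convexity em ℝ
  open SumProperties semiring using (sum-cong-≋; sum-cong-≗)
  open PartialOrderReasoning ≤-poset
  open Polytope P

  IsArb : (V → V) → Set
  IsArb = IsArborescence P c vₒₚₜ

  Ψ : (V → V) → Point d
  Ψ = ψ P c vₒₚₜ η

  σ : Point d → V → V → Carrier
  σ = slope P c vₒₚₜ η

  Ψ-cong : ∀ {𝒜 ℬ} → 𝒜 ≗ ℬ → Ψ 𝒜 ≋ Ψ ℬ
  Ψ-cong 𝒜≗ℬ i = reflexive (sum-cong-≗ (λ v →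
    ≡.cong (λ u → (η (pt u ⊖ pt v) ⁻¹ ⊛ (pt u ⊖ pt v)) i) (𝒜≗ℬ v)))

  IsArb-resp-≗ : ∀ {𝒜 ℬ} → 𝒜 ≗ ℬ → IsArb 𝒜 → IsArb ℬ
  IsArb-resp-≗ 𝒜≗ℬ (fixes , improves) =
    ≡.trans (≡.sym (𝒜≗ℬ vₒₚₜ)) fixes ,
    λ v v≢ → ≡.subst (_∈ Nb P c v) (𝒜≗ℬ v) (improves v v≢)

  -- By definition `Π` is the convex hull of this set, so results on `conv` apply directly.
  Values : Pred (Point d) 0ℓ
  Values x = ∃[ 𝒜 ] (IsArb 𝒜 × x ≋ Ψ 𝒜)

  isPolytope-Π : IsPolytope (Π P c vₒₚₜ η)
  isPolytope-Π with em {∃[ 𝒜 ] IsArb 𝒜}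
  ... | no none = conv-isPolytope {n = 0} Values (λ ())
    ((λ { (𝒜 , arb , _) → ⊥-elim (none (𝒜 , arb)) }) , λ ())
  ... | yes (𝒜₀ , arb₀) = conv-isPolytope Values (Ψ ∘ candidate)
    ( (λ { (𝒜 , arb , x≋) →
           funToFin 𝒜 , λ i → trans (x≋ i) (Ψ-cong (candidate-hits arb) i) })
    , (λ { (k , x≋) → candidate k , candidate-arb k , x≋ }) )
    where
    arborescence-or-𝒜₀ : (𝒜 : V → V) → Dec (IsArb 𝒜) → V → V
    arborescence-or-𝒜₀ 𝒜 (yes _) = 𝒜
    arborescence-or-𝒜₀ 𝒜 (no _)  = 𝒜₀

    -- finToFun lists all maps V → V; those that are not arborescences become 𝒜₀.
    candidate : Fin _ → V → V
    candidate k = arborescence-or-𝒜₀ (finToFun k) em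

    candidate-arb : ∀ k → IsArb (candidate k)
    candidate-arb k with em {IsArb (finToFun k)}
    ... | yes arb = arb
    ... | no _    = arb₀

    -- Encoding and decoding recovers `𝒜` only pointwise, so being an arborescence has to be
    -- transported along `≗`.
    candidate-hits : ∀ {𝒜} → IsArb 𝒜 → 𝒜 ≗ candidate (funToFin 𝒜)
    candidate-hits {𝒜} arb v with em {IsArb (finToFun (funToFin 𝒜))}
    ... | yes _   = ≡.sym (finToFun-funToFin 𝒜 v)
    ... | no ¬arb = ⊥-elim (¬arb (IsArb-resp-≗ (≡.sym ∘ finToFun-funToFin 𝒜) arb))

  -- Pure linearity of `w`, hence valid for every map `V → V`.
  ∙-Ψ : ∀ w 𝒜 → w ∙ Ψ 𝒜 ≈ sum (λ v → σ w v (𝒜 v))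
  ∙-Ψ w 𝒜 = trans (∙-∑ w (λ v → η (pt (𝒜 v) ⊖ pt v) ⁻¹ ⊛ (pt (𝒜 v) ⊖ pt v)))
    (sum-cong-≋ (λ v → trans (∙-⊛ w (η (pt (𝒜 v) ⊖ pt v) ⁻¹) (pt (𝒜 v) ⊖ pt v)) (*-comm _ _)))

  -- The pivot arborescence as unique optimum of a generic weight.

  module _ (w : Point d) (g : GenericWeight P c vₒₚₜ η w) where

    𝒜ʷ : V → V
    𝒜ʷ = pivot P c vₒₚₜ η w g

    pivot-fixes : 𝒜ʷ vₒₚₜ ≡ vₒₚₜ
    pivot-fixes with vₒₚₜ ≟ vₒₚₜ
    ... | yes _ = ≡.refl
    ... | no ≢  = ⊥-elim (≢ ≡.refl)

    pivot-maximizer : ∀ v → v ≢ vₒₚₜ → IsMaximizer P c vₒₚₜ η w v (𝒜ʷ v)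
    pivot-maximizer v v≢ with v ≟ vₒₚₜ
    ... | yes v≡ = ⊥-elim (v≢ v≡)
    ... | no v≢′ = proj₁ (proj₂ (g v v≢′))

    pivot-unique : ∀ v → v ≢ vₒₚₜ → ∀ {u} → IsMaximizer P c vₒₚₜ η w v u → 𝒜ʷ v ≡ u
    pivot-unique v v≢ max with v ≟ vₒₚₜ
    ... | yes v≡ = ⊥-elim (v≢ v≡)
    ... | no v≢′ = proj₂ (proj₂ (g v v≢′)) max

    pivot-arborescence : IsArb 𝒜ʷ
    pivot-arborescence = pivot-fixes , λ v v≢ → proj₁ (pivot-maximizer v v≢)

    module _ {ℬ : V → V} (arb : IsArb ℬ) where

      -- All arborescences fix `vₒₚₜ`, so their summands there are equal; genericity of `w` governs
      -- only the other vertices.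
      agree-at-vₒₚₜ : ∀ {v} → v ≡ vₒₚₜ → 𝒜ʷ v ≡ ℬ v
      agree-at-vₒₚₜ ≡.refl = ≡.trans pivot-fixes (≡.sym (proj₁ arb))

      slope≤slope-pivot : ∀ v → σ w v (ℬ v) ≤ σ w v (𝒜ʷ v)
      slope≤slope-pivot v = case v ≟ vₒₚₜ of λ where
        (yes v≡) → ≤-reflexive (reflexive (≡.cong (σ w v) (≡.sym (agree-at-vₒₚₜ v≡))))
        (no v≢)  → proj₂ (pivot-maximizer v v≢) (ℬ v) (proj₂ arb v v≢)

      ∙-Ψ≤∙-Ψ-pivot : w ∙ Ψ ℬ ≤ w ∙ Ψ 𝒜ʷ
      ∙-Ψ≤∙-Ψ-pivot = begin
        w ∙ Ψ ℬ                   ≈⟨ ∙-Ψ w ℬ ⟩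
        sum (λ v → σ w v (ℬ v))   ≤⟨ sum-mono-≤ slope≤slope-pivot ⟩
        sum (λ v → σ w v (𝒜ʷ v))  ≈⟨ ∙-Ψ w 𝒜ʷ ⟨
        w ∙ Ψ 𝒜ʷ                  ∎

      -- Equal totals with termwise bounds force equal slopes at each vertex. Hence `ℬ v` is also a
      -- maximizer at `v`, and genericity of `w` leaves only one.
      pivot-unique-optimum : w ∙ Ψ ℬ ≈ w ∙ Ψ 𝒜ʷ → 𝒜ʷ ≗ ℬ
      pivot-unique-optimum equal v = case v ≟ vₒₚₜ of λ where
          (yes v≡) → agree-at-vₒₚₜ v≡
          (no v≢)  → pivot-unique v v≢
            ( proj₂ arb v v≢
            , λ u u∈Nb → ≤-respʳ-≈ (sym (slopes≈ v)) (proj₂ (pivot-maximizer v v≢) u u∈Nb) )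
        where
        slopes≈ : ∀ u → σ w u (ℬ u) ≈ σ w u (𝒜ʷ u)
        slopes≈ = sum-≤-equality slope≤slope-pivot
          (≤-reflexive (trans (sym (∙-Ψ w 𝒜ʷ)) (trans (sym equal) (∙-Ψ w ℬ))))

    -- A generator reaching the optimal value comes from a map agreeing with `𝒜ʷ`, so it is the same
    -- point; the face is therefore a vertex of `Π`.
    Π-face : Π P c vₒₚₜ η ^ w ≐ (_≋ Ψ 𝒜ʷ)
    Π-face = conv-face-singleton {S = Values}
      (𝒜ʷ , pivot-arborescence , λ _ → refl)
      (λ { (ℬ , arb , p≋) → ≤-respˡ-≈ (sym (∙-congˡ w p≋)) (∙-Ψ≤∙-Ψ-pivot arb) })
      (λ { (ℬ , arb , p≋) equal i → trans (p≋ i) (sym (Ψ-cong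
             (pivot-unique-optimum arb (trans (sym (∙-congˡ w p≋)) equal)) i)) })

  -- Comparison of two generic weights.

  module _ (w w′ : Point d)
           (g : GenericWeight P c vₒₚₜ η w) (g′ : GenericWeight P c vₒₚₜ η w′) where

    same-pivot⇒same-face : 𝒜ʷ w g ≗ 𝒜ʷ w′ g′ → Π P c vₒₚₜ η ^ w ≐ Π P c vₒₚₜ η ^ w′
    same-pivot⇒same-face same =
      (λ x∈ → proj₂ (Π-face w′ g′) (λ i → trans (proj₁ (Π-face w g) x∈ i) (Ψ-cong same i))) ,
      (λ x∈ → proj₂ (Π-face w g) (λ i → trans (proj₁ (Π-face w′ g′) x∈ i) (sym (Ψ-cong same i))))

    -- Injectivity of `Ψ` on arborescences is not assumed; the maps are identified because both
    -- attain the optimum of `w`.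
    same-face⇒same-pivot : Π P c vₒₚₜ η ^ w ≐ Π P c vₒₚₜ η ^ w′ → 𝒜ʷ w g ≗ 𝒜ʷ w′ g′
    same-face⇒same-pivot (_ , ⊇) =
      pivot-unique-optimum w g (pivot-arborescence w′ g′) (∙-congˡ w Ψ′≋Ψ)
      where
      Ψ′≋Ψ : Ψ (𝒜ʷ w′ g′) ≋ Ψ (𝒜ʷ w g)
      -- The point `Ψ (𝒜ʷ w′ g′)` lies in its own face for `w′`, hence in the face for `w`, which is
      -- a single point.
      Ψ′≋Ψ = proj₁ (Π-face w g) (⊇ (proj₂ (Π-face w′ g′) (λ _ → refl)))

theorem1p4 :
  ExcludedMiddle 0ℓ → (ℝ : CompleteOrderedField) →
  let open CompleteOrderedField ℝ
      open PivotRules ℝ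
      open Polytope in
  ∀ {d} (P : Polytope d) (c : Point d) → GenericObjective P c →
  (vₒₚₜ : V P) → IsOptimal P c vₒₚₜ →
  (η : Point d → Carrier) → IsNormalization P c η →
  IsPolytope (Π P c vₒₚₜ η) ×
  (∀ (w w′ : Point d)
     (g : GenericWeight P c vₒₚₜ η w) (g′ : GenericWeight P c vₒₚₜ η w′) →
     (pivot P c vₒₚₜ η w g ≗ pivot P c vₒₚₜ η w′ g′) ⇔
     ((Π P c vₒₚₜ η ^ w) ≐ (Π P c vₒₚₜ η ^ w′)))
theorem1p4 em ℝ P c _ vₒₚₜ _ η _ =
  isPolytope-Π , λ w w′ g g′ →
    mk⇔ (same-pivot⇒same-face w w′ g g′) (same-face⇒same-pivot w w′ g g′)
  where open PivotRulePolytope em ℝ P c vₒₚₜ η
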